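{- Fix $k \in \mathbb{Z}_{\ge 0}$, $b \in \{0,1,2\}$, and an integer $m > 24k + 12 - 8b$ with $m \equiv b \pmod 3$. Then for every integer $n \ge m$ with $n \equiv b \pmod 3$, $$h_{n, d_n - k} = \sum_{l=0}^{k} h_{m, d_m - l} \binom{d_n - d_m}{k-l}.$$
   Context: A numerical semigroup is a subset of $\mathbb{Z}_{\ge 0}$ containing $0$ and closed under addition; $\langle A\rangle$ denotes the numerical semigroup generated by $A \subset \mathbb{Z}_{\ge 1}$ (all finite non-negative integer combinations of elements of $A$). A set $A$ minimally generates $\langle A \rangle$ if $\langle A \setminus\{x\}\rangle \ne \langle A \rangle$ for every $x \in A$. For $n \in \mathbb{Z}_{\ge 1}$ and $i \in \mathbb{Z}_{\ge 0}$, $h_{n,i}$ is the number of sets $A \subset [1, n/2) \cap \mathbb{Z}$ with $|A| = i$ that minimally generate a numerical semigroup with $n \notin \langle A \rangle$. For $n \in \mathbb{Z}_{\ge 1}$, $d_n = |(n/3, n/2) \cap \mathbb{Z}| = \lfloor (n-1)/2 \rfloor - \lfloor n/3 \rfloor$ (number of integers strictly between $n/3$ and $n/2$). Binomial coefficients $\binom{a}{j}$ with $j > a \ge 0$ are $0$. -}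

module Defs where

open import Data.Nat using (ℕ; zero; suc; _+_; _∸_; _/_)
open import Data.Fin using (Fin; toℕ)
open import Data.Fin.Subset using (Subset; _∈_; ∣_∣)
open import Data.Product using (Σ; _×_; _,_)
open import Data.List using (List; length)
open import Data.List.Relation.Unary.Unique.Propositional using (Unique)
import Data.List.Membership.Propositional as LM
open import Relation.Binary.PropositionalEquality using (_≡_; _≢_)
open import Relation.Nullary using (¬_)
open import Function.Bundles using (_⇔_)

data Gen (P : ℕ → Set) : ℕ → Set where
  gen0    : Gen P 0
  genStep : ∀ {a m} → P a → Gen P m → Gen P (a + m)

SameSet : (ℕ → Set) → (ℕ → Set) → Set
SameSet X Y = ∀ m → X m ⇔ Y m

MinGen : (ℕ → Set) → Set
MinGen P = ∀ x → P x → ¬ SameSet (Gen (λ y → P y × y ≢ x)) (Gen P)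

-- Integers in [1, n/2) are 1, …, ⌊(n-1)/2⌋ ; there are c n of them.
c : ℕ → ℕ
c n = (n ∸ 1) / 2

-- A subset S of Fin (c n) encodes A = { j+1 | j ∈ S } ⊂ [1, n/2).
Elem : ∀ {k} → Subset k → ℕ → Set
Elem {k} S y = Σ (Fin k) (λ j → (suc (toℕ j) ≡ y) × (j ∈ S))

HSet : (n : ℕ) → ℕ → Subset (c n) → Set
HSet n i S = (∣ S ∣ ≡ i) × MinGen (Elem S) × ¬ Gen (Elem S) n

IsCount : ∀ {k} → (Subset k → Set) → ℕ → Set
IsCount {k} P N =
  Σ (List (Subset k)) (λ L → Unique L × (∀ S → (S LM.∈ L) ⇔ P S) × (length L ≡ N))

d : ℕ → ℕ
d n = (n ∸ 1) / 2 ∸ n / 3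

sumTo : ℕ → (ℕ → ℕ) → ℕ
sumTo zero f = f 0
sumTo (suc k) f = sumTo k f + f (suc k)

{-# OPTIONS --safe #-}
-- Write n = 3q + b and let A ⊂ [1, n/2) be minimally generating with n ∉ ⟨A⟩. For a ∈ A the residues
-- mod a of the elements x, of their complements n − x, and of n/2 if n is even, are pairwise distinct,
-- so 2|A| (+ 1 if n is even) ≤ a. Hence |A| ≤ d n, and if |A| ≥ d n − k then every element is at least
-- q + b − (2k + 1), which exceeds n/4 by the hypothesis on m. For sets inside (n/4, n/2) both conditions
-- together just say that no three elements sum to n, a condition on the offsets x − q only. An element of
-- offset larger than d m ≥ 4k + 2 − b is too large to take part in such a sum. So the sets for n are
-- obtained from those for m by shifting by n/3 − m/3 and adding an arbitrary subset of the d n − d m new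
-- positions.
module Submission where

open import Defs
open import Data.Nat
open import Data.Nat.Properties
open import Data.Nat.Combinatorics using (_C_; nCk+nC[k+1]≡[n+1]C[k+1])
open import Data.Nat.DivMod using (m≡m%n+[m/n]*n; m%n<n; /-monoˡ-≤)
open import Data.Nat.Tactic.RingSolver using (solve)
open import Data.Empty using (⊥; ⊥-elim)
open import Data.Fin as Fin using (toℕ; fromℕ<)
open import Data.Fin.Properties using (toℕ<n; injective⇒≤; fromℕ<-injective)
open import Data.Fin.Subset using (Subset; ∣_∣; inside; outside) renaming (⊥ to ∅)
open import Data.Fin.Subset.Properties using (∣p∣≤n; ∣⊥∣≡0; ∉⊥; Empty-unique)
open import Data.List using (List; []; _∷_; length; map; lookup; cartesianProductWith)
import Data.List as List
-- The ring solver macro cannot disambiguate overloaded list constructors.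
open import Data.List using () renaming (_∷_ to _⨾_; [] to ε)
open import Data.List.Properties using (length-map; length-++)
open import Data.List.Membership.Propositional using () renaming (_∈_ to _∈ˡ_)
open import Data.List.Membership.Propositional.Properties
  using (∈-map⁺; ∈-map⁻; ∈-++⁺ˡ; ∈-++⁺ʳ; ∈-++⁻; ∈-lookup;
         ∈-cartesianProductWith⁺; ∈-cartesianProductWith⁻)
open import Data.List.Membership.Propositional.Properties.WithK using (unique∧set⇒bag)
open import Data.List.Relation.Binary.BagAndSetEquality using (∼bag⇒↭)
open import Data.List.Relation.Binary.Permutation.Propositional.Properties using (↭-length)
open import Data.List.Relation.Unary.All as All using ([]; _∷_)
import Data.List.Relation.Unary.All.Properties as All
open import Data.List.Relation.Unary.AllPairs using ([]; _∷_)
open import Data.List.Relation.Unary.Any using (here; there)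
open import Data.List.Relation.Unary.Unique.Propositional using (Unique)
import Data.List.Relation.Unary.Unique.Propositional.Properties as Unique
open import Data.Product using (∃; ∃₂; _×_; _,_; proj₁; proj₂)
open import Data.Sum as Sum using (_⊎_; inj₁; inj₂)
open import Data.Vec using ([]; _∷_; here; there; _++_; splitAt)
open import Data.Vec.Properties using (∷-injective; ++-injective)
open import Function using (_∘_; case_of_)
open import Function.Bundles using (_⇔_; mk⇔; Equivalence)
open import Relation.Nullary using (¬_; contradiction; yes; no)
open import Relation.Binary.PropositionalEquality

open Equivalence using (to; from)

private
  variable
    u v w M N : ℕ

-- Counting

-- Duplicate-free lists with the same members are bag equal, hence permutations of each other and
-- equally long.
IsCount-unique : {P Q : Subset u → Set} → (∀ S → P S ⇔ Q S) →
                 IsCount P M → IsCount Q N → M ≡ N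
IsCount-unique P⇔Q (xs , xs! , ∈xs⇔P , refl) (ys , ys! , ∈ys⇔Q , refl) =
  ↭-length (∼bag⇒↭ (unique∧set⇒bag xs! ys! λ {S} →
    mk⇔ (from (∈ys⇔Q S) ∘ to (P⇔Q S) ∘ to (∈xs⇔P S))
        (from (∈xs⇔P S) ∘ from (P⇔Q S) ∘ to (∈ys⇔Q S))))

IsCount-⇔ : {P Q : Subset u → Set} → (∀ S → P S ⇔ Q S) → IsCount P M → IsCount Q M
IsCount-⇔ P⇔Q (xs , xs! , ∈xs⇔P , len) =
  xs , xs! , (λ S → mk⇔ (to (P⇔Q S) ∘ to (∈xs⇔P S)) (from (∈xs⇔P S) ∘ from (P⇔Q S))) , len

IsCount-⊎ : {P Q : Subset u → Set} → (∀ {S} → P S → ¬ Q S) →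
            IsCount P M → IsCount Q N → IsCount (λ S → P S ⊎ Q S) (M + N)
IsCount-⊎ disjoint (xs , xs! , ∈xs⇔P , refl) (ys , ys! , ∈ys⇔Q , refl) =
  xs List.++ ys ,
  Unique.++⁺ xs! ys! (λ (∈xs , ∈ys) → disjoint (to (∈xs⇔P _) ∈xs) (to (∈ys⇔Q _) ∈ys)) ,
  (λ S → mk⇔
    (λ S∈ → Sum.map (to (∈xs⇔P S)) (to (∈ys⇔Q S)) (∈-++⁻ xs S∈))
    λ { (inj₁ p) → ∈-++⁺ˡ (from (∈xs⇔P S) p)
      ; (inj₂ q) → ∈-++⁺ʳ xs (from (∈ys⇔Q S) q) }) ,
  length-++ xs

Image₂ : (Subset u → Subset v → Subset w) → (Subset u → Set) → (Subset v → Set) →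
         Subset w → Set
Image₂ f P Q S = ∃₂ λ A B → P A × Q B × S ≡ f A B

length-cartesianProductWith : {A B C : Set} (f : A → B → C) (xs : List A) (ys : List B) →
  length (cartesianProductWith f xs ys) ≡ length xs * length ys
length-cartesianProductWith f []       ys = refl
length-cartesianProductWith f (x ∷ xs) ys =
  trans (length-++ (map (f x) ys))
        (cong₂ _+_ (length-map (f x) ys) (length-cartesianProductWith f xs ys))

IsCount-Image₂ : {P : Subset u → Set} {Q : Subset v → Set} (f : Subset u → Subset v → Subset w) →
  (∀ {A A′ B B′} → f A B ≡ f A′ B′ → A ≡ A′ × B ≡ B′) →
  IsCount P M → IsCount Q N → IsCount (Image₂ f P Q) (M * N)
IsCount-Image₂ f f-inj (xs , xs! , ∈xs⇔P , refl) (ys , ys! , ∈ys⇔Q , refl) =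
  cartesianProductWith f xs ys ,
  Unique.cartesianProductWith⁺ f f-inj xs! ys! ,
  (λ S → mk⇔
    (λ S∈ → let A , B , A∈ , B∈ , eq = ∈-cartesianProductWith⁻ f xs ys S∈
            in A , B , to (∈xs⇔P A) A∈ , to (∈ys⇔Q B) B∈ , eq)
    λ { (A , B , p , q , refl) →
        ∈-cartesianProductWith⁺ f (from (∈xs⇔P A) p) (from (∈ys⇔Q B) q) }) ,
  length-cartesianProductWith f xs ys

IsCount-sumTo : {P : ℕ → Subset u → Set} {g : ℕ → ℕ} →
  (k : ℕ) → (∀ {i j S} → i ≤ k → j ≤ k → P i S → P j S → i ≡ j) →
  (∀ i → i ≤ k → IsCount (P i) (g i)) → IsCount (λ S → ∃ λ i → i ≤ k × P i S) (sumTo k g)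
IsCount-sumTo zero    disjoint   counts =
  IsCount-⇔ (λ S → mk⇔ (λ p → 0 , z≤n , p) λ { (0 , z≤n , p) → p }) (counts 0 z≤n)
IsCount-sumTo {P = P} (suc k) disjoint counts =
  IsCount-⇔ (λ S → mk⇔ join (split S))
    (IsCount-⊎ (λ { (i , i≤k , p) q → 1+n≰n (subst (_≤ k) (disjoint (m≤n⇒m≤1+n i≤k) ≤-refl p q) i≤k) })
      (IsCount-sumTo k (λ i≤k j≤k → disjoint (m≤n⇒m≤1+n i≤k) (m≤n⇒m≤1+n j≤k))
        (λ i i≤k → counts i (m≤n⇒m≤1+n i≤k)))
      (counts (suc k) ≤-refl))
  where
  join : ∀ {S} → (∃ λ i → i ≤ k × P i S) ⊎ P (suc k) S → ∃ λ i → i ≤ suc k × P i S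
  join (inj₁ (i , i≤k , p)) = i , m≤n⇒m≤1+n i≤k , p
  join (inj₂ p)             = suc k , ≤-refl , p
  split : ∀ S → (∃ λ i → i ≤ suc k × P i S) → (∃ λ i → i ≤ k × P i S) ⊎ P (suc k) S
  split S (i , i≤1+k , p) with m≤n⇒m<n∨m≡n i≤1+k
  ... | inj₁ i<1+k = inj₁ (i , s≤s⁻¹ i<1+k , p)
  ... | inj₂ refl  = inj₂ p

-- A case distinction on the first position: the combinatorial side of Pascal's rule.
OnHead : (Subset u → Set) → (Subset u → Set) → Subset (suc u) → Set
OnHead P Q (inside  ∷ S) = P S
OnHead P Q (outside ∷ S) = Q S

IsCount-∷ : {P Q : Subset u → Set} → IsCount P M → IsCount Q N → IsCount (OnHead P Q) (M + N)
IsCount-∷ (xs , xs! , ∈xs⇔P , refl) (ys , ys! , ∈ys⇔Q , refl) =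
  map (inside ∷_) xs List.++ map (outside ∷_) ys ,
  Unique.++⁺ (Unique.map⁺ (proj₂ ∘ ∷-injective) xs!) (Unique.map⁺ (proj₂ ∘ ∷-injective) ys!)
    (λ (∈ins , ∈out) → case ∈-map⁻ _ ∈ins , ∈-map⁻ _ ∈out of
      λ { ((_ , _ , refl) , (_ , _ , ())) }) ,
  (λ { (inside ∷ S) → mk⇔
         (λ S∈ → case ∈-++⁻ (map (inside ∷_) xs) S∈ of
           λ { (inj₁ ∈ins) → case ∈-map⁻ _ ∈ins of λ { (_ , ∈xs , refl) → to (∈xs⇔P S) ∈xs }
             ; (inj₂ ∈out) → case ∈-map⁻ _ ∈out of λ { (_ , _ , ()) } })
         (λ p → ∈-++⁺ˡ (∈-map⁺ _ (from (∈xs⇔P S) p)))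
     ; (outside ∷ S) → mk⇔
         (λ S∈ → case ∈-++⁻ (map (inside ∷_) xs) S∈ of
           λ { (inj₁ ∈ins) → case ∈-map⁻ _ ∈ins of λ { (_ , _ , ()) }
             ; (inj₂ ∈out) → case ∈-map⁻ _ ∈out of λ { (_ , ∈ys , refl) → to (∈ys⇔Q S) ∈ys } })
         (λ q → ∈-++⁺ʳ (map (inside ∷_) xs) (∈-map⁺ _ (from (∈ys⇔Q S) q))) }) ,
  trans (length-++ (map (inside ∷_) xs)) (cong₂ _+_ (length-map _ xs) (length-map _ ys))

IsCount-∅ : IsCount {u} (λ _ → ⊥) 0
IsCount-∅ = [] , [] , (λ S → mk⇔ (λ ()) ⊥-elim) , refl

-- Sets are indexed by the number `j` of omitted positions, which is how the binomials of the
-- theorem count; for j > D there are none.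
CoSize : (D j : ℕ) → Subset D → Set
CoSize D j F = ∣ F ∣ + j ≡ D

IsCount-CoSize : ∀ D j → IsCount (CoSize D j) (D C j)
IsCount-CoSize zero    zero    =
  [] ∷ [] , [] ∷ [] , (λ { [] → mk⇔ (λ _ → refl) (λ _ → here refl) }) , refl
IsCount-CoSize zero    (suc j) = [] , [] , (λ { [] → mk⇔ (λ ()) (λ ()) }) , refl
IsCount-CoSize (suc D) zero    =
  IsCount-⇔
    (λ { (inside ∷ F)  → mk⇔ (cong suc) suc-injective
       ; (outside ∷ F) → mk⇔ ⊥-elim
           (λ eq → 1+n≰n (subst (_≤ D) (trans (sym (+-identityʳ ∣ F ∣)) eq) (∣p∣≤n F))) })
    (IsCount-∷ (IsCount-CoSize D 0) IsCount-∅)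
IsCount-CoSize (suc D) (suc j) =
  -- With the first position inside, all omissions fall on the rest; with it outside, one is used
  -- up. The summands of Pascal's rule thus come in swapped order.
  subst (IsCount _) (trans (+-comm (D C suc j) (D C j)) (nCk+nC[k+1]≡[n+1]C[k+1] D j))
    (IsCount-⇔
      (λ { (inside ∷ F)  → mk⇔ (cong suc) suc-injective
         ; (outside ∷ F) → mk⇔ (λ eq → trans (+-suc ∣ F ∣ j) (cong suc eq))
             (λ eq → suc-injective (trans (sym (+-suc ∣ F ∣ j)) eq)) })
      (IsCount-∷ (IsCount-CoSize D (suc j)) (IsCount-CoSize D j)))

-- A linear contradiction is certified by adding up inequalities: the left side of the sum exceeds the right
-- side by suc s, which is a semiring identity. Being abstract keeps the solver's proof terms from being unfolded.
abstract
  absurd-≤ : ∀ {x y} s → x ≤ y → x ≡ suc (y + s) → ⊥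
  absurd-≤ {y = y} s x≤y refl = 1+n≰n (≤-trans (s≤s (m≤m+n y s)) x≤y)

infixr 4 _⊕_
infixr 5 _⊛_

_⊕_ : ∀ {x y z t} → x ≤ y → z ≤ t → x + z ≤ y + t
_⊕_ = +-mono-≤

_⊛_ : ∀ i {x y} → x ≤ y → i * x ≤ i * y
i ⊛ x≤y = *-monoʳ-≤ i x≤y

-- Pigeonhole principle for duplicate-free lists

module _ {A : Set} where

  lookup-injective : {xs : List A} → Unique xs → ∀ {i j} → lookup xs i ≡ lookup xs j → i ≡ j
  lookup-injective (_    ∷ _)   {Fin.zero}  {Fin.zero}  eq = refl
  lookup-injective (x∉xs ∷ _)   {Fin.zero}  {Fin.suc j} eq = contradiction eq (All.lookup x∉xs (∈-lookup j))
  lookup-injective (x∉xs ∷ _)   {Fin.suc i} {Fin.zero}  eq =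
    contradiction (sym eq) (All.lookup x∉xs (∈-lookup i))
  lookup-injective (_    ∷ xs!) {Fin.suc i} {Fin.suc j} eq = cong Fin.suc (lookup-injective xs! eq)

  -- Injectivity is asked only on members of the list, since `n ∸_` and `_% a` are not injective on
  -- all of ℕ.
  map-unique : {B : Set} {f : A → B} {xs : List A} →
    (∀ {x y} → x ∈ˡ xs → y ∈ˡ xs → f x ≡ f y → x ≡ y) → Unique xs → Unique (map f xs)
  map-unique inj []           = []
  map-unique inj (x∉xs ∷ xs!) =
    All.map⁺ (All.tabulate λ y∈ eq → All.lookup x∉xs y∈ (inj (here refl) (there y∈) eq))
    ∷ map-unique (λ x∈ y∈ → inj (there x∈) (there y∈)) xs!

pigeonhole : ∀ {xs} → Unique xs → (∀ {x} → x ∈ˡ xs → x < N) → length xs ≤ N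
pigeonhole xs! xs<N = injective⇒≤ {f = λ i → fromℕ< (xs<N (∈-lookup i))}
  (λ {i} {j} eq → lookup-injective xs! (fromℕ<-injective _ _ (xs<N (∈-lookup i)) (xs<N (∈-lookup j)) eq))

-- Elements of an encoded set

Elem-there : ∀ {s} {S : Subset u} {x} → Elem S x → Elem (s ∷ S) (suc x)
Elem-there (j , refl , j∈S) = Fin.suc j , refl , there j∈S

Elem-∷⁻ : ∀ {s} {S : Subset u} {x} → Elem (s ∷ S) x →
          (s ≡ inside × x ≡ 1) ⊎ (∃ λ y → x ≡ suc y × Elem S y)
Elem-∷⁻ (Fin.zero  , refl , here)      = inj₁ (refl , refl)
Elem-∷⁻ (Fin.suc j , refl , there j∈S) = inj₂ (suc (toℕ j) , refl , j , refl , j∈S)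

Elem⇒>0 : {S : Subset u} {x : ℕ} → Elem S x → 0 < x
Elem⇒>0 (_ , refl , _) = z<s

Elem⇒≤ : {S : Subset u} {x : ℕ} → Elem S x → x ≤ u
Elem⇒≤ (j , refl , _) = toℕ<n j

elements : Subset u → List ℕ
elements []            = []
elements (inside  ∷ S) = 1 ∷ map suc (elements S)
elements (outside ∷ S) = map suc (elements S)

∈-elements⁻ : (S : Subset u) {x : ℕ} → x ∈ˡ elements S → Elem S x
∈-elements⁻ (inside  ∷ S) (here refl) = Fin.zero , refl , here
∈-elements⁻ (inside  ∷ S) (there x∈)  with _ , y∈ , refl ← ∈-map⁻ suc x∈ = Elem-there (∈-elements⁻ S y∈)
∈-elements⁻ (outside ∷ S) x∈          with _ , y∈ , refl ← ∈-map⁻ suc x∈ = Elem-there (∈-elements⁻ S y∈)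

elements-unique : (S : Subset u) → Unique (elements S)
elements-unique []            = []
elements-unique (inside  ∷ S) =
  All.map⁺ (All.tabulate λ y∈ eq → <⇒≢ (Elem⇒>0 (∈-elements⁻ S y∈)) (suc-injective eq))
  ∷ Unique.map⁺ suc-injective (elements-unique S)
elements-unique (outside ∷ S) = Unique.map⁺ suc-injective (elements-unique S)

length-elements : (S : Subset u) → length (elements S) ≡ ∣ S ∣
length-elements []            = refl
length-elements (inside  ∷ S) = cong suc (trans (length-map suc (elements S)) (length-elements S))
length-elements (outside ∷ S) = trans (length-map suc (elements S)) (length-elements S)

-- Subtracting q + 1 sends the elements to distinct numbers below d.
∣S∣≤N∸q : ∀ {q d} (S : Subset u) → (∀ {x} → Elem S x → q < x × x ≤ q + d) → ∣ S ∣ ≤ d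
∣S∣≤N∸q {q = q} {d} S bounds = begin
  ∣ S ∣                                ≡⟨ length-elements S ⟨
  length (elements S)                  ≡⟨ length-map (_∸ suc q) (elements S) ⟨
  length (map (_∸ suc q) (elements S)) ≤⟨ pigeonhole
     (map-unique (λ x∈ y∈ → ∸-cancelʳ-≡ (q<∈ x∈) (q<∈ y∈)) (elements-unique S))
     (λ x∈ → case ∈-map⁻ (_∸ suc q) x∈ of λ { (y , y∈ , refl) →
        +-cancelˡ-< q _ _ (subst (_≤ q + d) (sym (m+[n∸m]≡n (q<∈ y∈)))
           (proj₂ (bounds (∈-elements⁻ S y∈)))) }) ⟩
  d ∎
  where
  open ≤-Reasoning
  q<∈ : ∀ {x} → x ∈ˡ elements S → q < x
  q<∈ x∈ = proj₁ (bounds (∈-elements⁻ S x∈))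

-- Minimal generation and residues

module _ {P : ℕ → Set} where

  Gen-+ : ∀ {x y} → Gen P x → Gen P y → Gen P (x + y)
  Gen-+ gen0 gy = gy
  Gen-+ {y = y} (genStep {a} {m} pa gx) gy =
    subst (Gen P) (sym (+-assoc a m y)) (genStep pa (Gen-+ gx gy))

  Gen-[_] : ∀ {x} → P x → Gen P x
  Gen-[ p ] = subst (Gen P) (+-identityʳ _) (genStep p gen0)

  Gen-* : ∀ {x} → P x → ∀ j → Gen P (j * x)
  Gen-* p zero    = gen0
  Gen-* p (suc j) = genStep p (Gen-* p j)

Gen-map : {P Q : ℕ → Set} → (∀ {x} → P x → Q x) → ∀ {x} → Gen P x → Gen Q x
Gen-map f gen0          = gen0
Gen-map f (genStep p g) = genStep (f p) (Gen-map f g)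

-- If the other generators produced x, every occurrence of x in a combination could be replaced by
-- that expression, and dropping x would not change the semigroup.
MinGen⇒irredundant : {P : ℕ → Set} {x : ℕ} → MinGen P → P x → ¬ Gen (λ y → P y × y ≢ x) x
MinGen⇒irredundant {P} {x} minimal p gx = minimal x p λ y → mk⇔ (Gen-map proj₁) remove
  where
  remove : ∀ {y} → Gen P y → Gen (λ z → P z × z ≢ x) y
  remove gen0 = gen0
  remove (genStep {a} pa g) with a ≟ x
  ... | yes refl = Gen-+ gx (remove g)
  ... | no a≢x   = genStep (pa , a≢x) (remove g)

%≡⇒∃ : ∀ a .{{_ : NonZero a}} {x y} → x % a ≡ y % a → x ≤ y → ∃ λ j → y ≡ x + j * a
%≡⇒∃ a {x} {y} eq x≤y = y / a ∸ x / a , (begin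
  y                                           ≡⟨ m≡m%n+[m/n]*n y a ⟩
  y % a + y / a * a                           ≡⟨ cong₂ (λ r i → r + i * a) eq (m+[n∸m]≡n (/-monoˡ-≤ a x≤y)) ⟨
  x % a + (x / a + (y / a ∸ x / a)) * a       ≡⟨ cong (x % a +_) (*-distribʳ-+ a (x / a) _) ⟩
  x % a + (x / a * a + (y / a ∸ x / a) * a)   ≡⟨ +-assoc (x % a) _ _ ⟨
  x % a + x / a * a + (y / a ∸ x / a) * a     ≡⟨ cong (_+ (y / a ∸ x / a) * a) (m≡m%n+[m/n]*n x a) ⟨
  x + (y / a ∸ x / a) * a                     ∎)
  where open ≡-Reasoning

module Residues {n : ℕ} {S : Subset N} (n>2N : 2 * N < n)
                (minimal : MinGen (Elem S)) (n∉ : ¬ Gen (Elem S) n) where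

  2x<n : ∀ {x} → Elem S x → 2 * x < n
  2x<n x∈S = ≤-<-trans (*-monoʳ-≤ 2 (Elem⇒≤ x∈S)) n>2N

  -- Multiples of elements of A are carried as opaque values t ∈ ⟨A⟩, which keeps the arithmetic linear.
  x+y+t≢n : ∀ {x y t} → Elem S x → Elem S y → Gen (Elem S) t → x + y + t ≢ n
  x+y+t≢n x∈S y∈S t∈⟨S⟩ refl = n∉ (Gen-+ (Gen-+ Gen-[ x∈S ] Gen-[ y∈S ]) t∈⟨S⟩)

  -- The sum is generated by x and a, which are both strictly smaller than it since both are
  -- positive.
  x+ja∉S : ∀ {a x} → Elem S a → Elem S x → ∀ j → ¬ Elem S (x + suc j * a)
  x+ja∉S {a} {x} a∈S x∈S j y∈S = MinGen⇒irredundant minimal y∈S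
    (Gen-+ Gen-[ x∈S , <⇒≢ x<y ] (Gen-* (a∈S , <⇒≢ a<y) (suc j)))
    where
    x<y : x < x + suc j * a
    x<y = m<m+n x (≤-trans (Elem⇒>0 a∈S) (m≤m+n a (j * a)))
    a<y : a < x + suc j * a
    a<y = ≤-<-trans (m≤m+n a (j * a)) (m<n+m (suc j * a) (Elem⇒>0 x∈S))

  data Class (r : ℕ) : Set where
    member     : Elem S r → Class r
    complement : ∀ {x} → Elem S x → r + x ≡ n → Class r
    middle     : r + r ≡ n → Class r

  -- Members lie below n/2 and complements above, so a positive step t never leads downwards or from
  -- n/2 to itself; those cases are pure arithmetic. In the others, r + t = s either writes n as two
  -- members plus t or 2t, or puts both some x and x + t into `S`.
  r+t≢s : ∀ {r s t} → 0 < t → Gen (Elem S) t → (∀ {x} → Elem S x → ¬ Elem S (x + t)) →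
          Class r → Class s → r + t ≢ s
  r+t≢s t>0 t∈⟨S⟩ x+t∉S (member r∈) (member s∈) refl = x+t∉S r∈ s∈
  r+t≢s {r} {s} {t} t>0 t∈⟨S⟩ x+t∉S (member r∈) (complement {x} x∈ s+x≡n) refl =
    x+y+t≢n r∈ x∈ t∈⟨S⟩ (trans r+x+t≡r+t+x s+x≡n)
    where
    r+x+t≡r+t+x : r + x + t ≡ r + t + x
    r+x+t≡r+t+x = solve (r ⨾ x ⨾ t ⨾ ε)
  r+t≢s {r} {s} {t} t>0 t∈⟨S⟩ x+t∉S (member r∈) (middle s+s≡n) refl =
    x+y+t≢n r∈ r∈ (Gen-+ t∈⟨S⟩ t∈⟨S⟩) (trans 2r+2t≡2[r+t] s+s≡n)
    where
    2r+2t≡2[r+t] : r + r + (t + t) ≡ r + t + (r + t)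
    2r+2t≡2[r+t] = solve (r ⨾ t ⨾ ε)
  r+t≢s {r} {s} {t} t>0 t∈⟨S⟩ x+t∉S (complement {x} x∈ r+x≡n) (member s∈) refl =
    absurd-≤ (1 + 2 * t) (2x<n s∈ ⊕ 2x<n x∈ ⊕ 2 ⊛ ≤-reflexive (sym r+x≡n))
      (solve (r ⨾ x ⨾ t ⨾ n ⨾ ε))
  r+t≢s {r} {s} {t} t>0 t∈⟨S⟩ x+t∉S (complement {x} x∈ r+x≡n) (complement {y} y∈ s+y≡n) refl =
    -- Complementing reverses the order: r + x = n = r + t + y gives x = y + t.
    x+t∉S y∈ (subst (Elem S) (+-cancelˡ-≡ r _ _ (trans (trans r+x≡n (sym s+y≡n)) r+t+y≡r+y+t)) x∈)
    where
    r+t+y≡r+y+t : r + t + y ≡ r + (y + t)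
    r+t+y≡r+y+t = solve (r ⨾ y ⨾ t ⨾ ε)
  r+t≢s {r} {s} {t} t>0 t∈⟨S⟩ x+t∉S (complement {x} x∈ r+x≡n) (middle s+s≡n) refl =
    absurd-≤ (2 * t) (2x<n x∈ ⊕ 2 ⊛ ≤-reflexive (sym r+x≡n) ⊕ ≤-reflexive s+s≡n)
      (solve (r ⨾ x ⨾ t ⨾ n ⨾ ε))
  r+t≢s {r} {s} {t} t>0 t∈⟨S⟩ x+t∉S (middle r+r≡n) (member s∈) refl =
    absurd-≤ (2 * t) (2x<n s∈ ⊕ ≤-reflexive (sym r+r≡n)) (solve (r ⨾ t ⨾ n ⨾ ε))
  r+t≢s {r} {s} {t} t>0 t∈⟨S⟩ x+t∉S (middle r+r≡n) (complement {y} y∈ s+y≡n) refl =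
    x+y+t≢n y∈ y∈ (Gen-+ t∈⟨S⟩ t∈⟨S⟩) (trans 2y+2t≡2[t+y] (trans (cong₂ _+_ t+y≡r t+y≡r) r+r≡n))
    where
    t+y≡r : t + y ≡ r
    t+y≡r = +-cancelˡ-≡ r _ _ (trans (sym (+-assoc r t y)) (trans s+y≡n (sym r+r≡n)))
    2y+2t≡2[t+y] : y + y + (t + t) ≡ t + y + (t + y)
    2y+2t≡2[t+y] = solve (y ⨾ t ⨾ ε)
  r+t≢s {r} {s} {t} t>0 t∈⟨S⟩ x+t∉S (middle r+r≡n) (middle s+s≡n) refl =
    absurd-≤ 1 (2 ⊛ t>0 ⊕ ≤-reflexive (trans s+s≡n (sym r+r≡n))) (solve (r ⨾ t ⨾ ε))

  -- Congruent representatives differ by a multiple of a, and a positive multiple is a step t in ⟨A⟩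
  -- that `r+t≢s` forbids.
  residue-injective : ∀ {a} .{{_ : NonZero a}} → Elem S a → ∀ {r s} → Class r → Class s →
                      r % a ≡ s % a → r ≡ s
  residue-injective {a} a∈S {r} {s} cr cs eq =
    case ≤-total r s of λ { (inj₁ r≤s) → ordered cr cs eq r≤s
                          ; (inj₂ s≤r) → sym (ordered cs cr (sym eq) s≤r) }
    where
    ordered : ∀ {r s} → Class r → Class s → r % a ≡ s % a → r ≤ s → r ≡ s
    ordered {r} cr cs eq r≤s with %≡⇒∃ a eq r≤s
    ... | zero  , s≡r+0 = sym (trans s≡r+0 (+-identityʳ r))
    ... | suc j , s≡r+t = contradiction (sym s≡r+t)
      (r+t≢s (≤-trans (Elem⇒>0 a∈S) (m≤m+n a (j * a))) (Gen-* a∈S (suc j))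
             (λ x∈S → x+ja∉S a∈S x∈S j) cr cs)

  -- The list is empty for n = 2N + 1 and holds n/2 = N + 1 for n = 2N + 2. The equation on its
  -- length lets both parities share one count.
  middles : n ≤ 2 * N + 2 →
    ∃ λ ms → Unique ms × (∀ {r} → r ∈ˡ ms → r + r ≡ n) × length ms + (2 * N + 1) ≡ n
  middles n≤2N+2 with m≤n⇒m<n∨m≡n n≤2N+2
  ... | inj₁ n<2N+2 = [] , [] , (λ ()) ,
    ≤-antisym (subst (_≤ n) (+-comm 1 (2 * N)) n>2N)
              (s≤s⁻¹ (subst (n <_) (+-suc (2 * N) 1) n<2N+2))
  ... | inj₂ n≡2N+2 = suc N ∷ [] , [] ∷ [] ,
    (λ { (here refl) → trans 2[1+N]≡2N+2 (sym n≡2N+2) }) ,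
    trans (sym (+-suc (2 * N) 1)) (sym n≡2N+2)
    where
    2[1+N]≡2N+2 : suc N + suc N ≡ 2 * N + 2
    2[1+N]≡2N+2 = solve (N ⨾ ε)

  -- The 2∣S∣ + `length ms` representatives have distinct residues mod a, so there are at most a of
  -- them; `length ms` is n - (2N + 1).
  residue-bound : n ≤ 2 * N + 2 → ∀ {a} → Elem S a → 2 * ∣ S ∣ + n ≤ a + (2 * N + 1)
  residue-bound n≤2N+2 {a} a∈S with ms , ms! , ∈ms , len ← middles n≤2N+2 = begin
    2 * ∣ S ∣ + n                                   ≡⟨ cong₂ (λ i j → 2 * i + j) (length-elements S) len ⟨
    2 * length xs + (length ms + (2 * N + 1))       ≡⟨ +-assoc (2 * length xs) _ _ ⟨
    2 * length xs + length ms + (2 * N + 1)         ≡⟨ cong (_+ (2 * N + 1)) length-rs ⟨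
    length (map (_% a) rs) + (2 * N + 1)            ≤⟨ +-monoˡ-≤ _ (pigeonhole
      (map-unique (λ r∈ s∈ → residue-injective a∈S (class r∈) (class s∈)) rs!)
      (λ r∈ → case ∈-map⁻ (_% a) r∈ of λ { (r , _ , refl) → m%n<n r a })) ⟩
    a + (2 * N + 1)                                 ∎
    where
    open ≤-Reasoning
    instance
      a≢0 : NonZero a
      a≢0 = >-nonZero (Elem⇒>0 a∈S)
    xs = elements S
    ys = map (n ∸_) xs
    rs = xs List.++ ys List.++ ms
    x<n : ∀ {x} → Elem S x → x < n
    x<n {x} x∈ = ≤-<-trans (m≤m+n x (x + 0)) (2x<n x∈)
    ∈ys : ∀ {r} → r ∈ˡ ys → ∃ λ x → Elem S x × r + x ≡ n
    ∈ys r∈ with x , x∈ , refl ← ∈-map⁻ (n ∸_) r∈ =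
      let x∈S = ∈-elements⁻ S x∈ in x , x∈S , m∸n+n≡m (<⇒≤ (x<n x∈S))
    class : ∀ {r} → r ∈ˡ rs → Class r
    class r∈ with ∈-++⁻ xs r∈
    ... | inj₁ r∈xs = member (∈-elements⁻ S r∈xs)
    ... | inj₂ r∈   with ∈-++⁻ ys r∈
    ... | inj₁ r∈ys = let _ , x∈S , r+x≡n = ∈ys r∈ys in complement x∈S r+x≡n
    ... | inj₂ r∈ms = middle (∈ms r∈ms)
    ys! : Unique ys
    ys! = map-unique (λ x∈ y∈ → ∸-cancelˡ-≡ (<⇒≤ (x<n (∈-elements⁻ S x∈))) (<⇒≤ (x<n (∈-elements⁻ S y∈))))
                     (elements-unique S)
    -- A number in two of the three lists would make n a sum of two elements of A.
    rs! : Unique rs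
    rs! = Unique.++⁺ (elements-unique S)
      (Unique.++⁺ ys! ms! λ (r∈ys , r∈ms) →
        let x , x∈S , r+x≡n = ∈ys r∈ys
            r≡x = +-cancelˡ-≡ _ _ _ (trans (∈ms r∈ms) (sym r+x≡n))
        in x+y+t≢n x∈S x∈S gen0 (trans (+-identityʳ (x + x)) (trans (cong (_+ x) (sym r≡x)) r+x≡n)))
      λ (r∈xs , r∈) → let r∈S = ∈-elements⁻ S r∈xs in case ∈-++⁻ ys r∈ of λ
        { (inj₁ r∈ys) → let x , x∈S , r+x≡n = ∈ys r∈ys
                        in x+y+t≢n r∈S x∈S gen0 (trans (+-identityʳ _) r+x≡n)
        ; (inj₂ r∈ms) → x+y+t≢n r∈S r∈S gen0 (trans (+-identityʳ _) (∈ms r∈ms)) }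
    length-rs : length (map (_% a) rs) ≡ 2 * length xs + length ms
    length-rs = trans (length-map (_% a) rs) (trans (length-++ xs) (trans
      (cong (length xs +_) (trans (length-++ ys) (cong (_+ length ms) (length-map (n ∸_) xs))))
      (lemma (length xs) (length ms))))
      where
      lemma : ∀ i j → i + (i + j) ≡ 2 * i + j
      lemma i j = solve (i ⨾ j ⨾ ε)

-- Concatenation of encoded sets

Elem-++⁺ˡ : {A : Subset u} {F : Subset v} {x : ℕ} → Elem A x → Elem (A ++ F) x
Elem-++⁺ˡ {A = s ∷ A} x∈A with Elem-∷⁻ x∈A
... | inj₁ (refl , refl)    = Fin.zero , refl , here
... | inj₂ (_ , refl , y∈A) = Elem-there (Elem-++⁺ˡ y∈A)

Elem-++⁺ʳ : (A : Subset u) {F : Subset v} {x : ℕ} → Elem F x → Elem (A ++ F) (u + x)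
Elem-++⁺ʳ []      x∈F = x∈F
Elem-++⁺ʳ (s ∷ A) x∈F = Elem-there (Elem-++⁺ʳ A x∈F)

Elem-++⁻ : (A : Subset u) {F : Subset v} {x : ℕ} → Elem (A ++ F) x →
           Elem A x ⊎ (∃ λ y → x ≡ u + y × Elem F y)
Elem-++⁻ []      x∈F = inj₂ (_ , refl , x∈F)
Elem-++⁻ (s ∷ A) x∈  with Elem-∷⁻ x∈
... | inj₁ (refl , refl) = inj₁ (Fin.zero , refl , here)
... | inj₂ (_ , refl , y∈) with Elem-++⁻ A y∈
... | inj₁ y∈A               = inj₁ (Elem-there y∈A)
... | inj₂ (z , refl , z∈F)  = inj₂ (z , refl , z∈F)

∣++∣ : (A : Subset u) (F : Subset v) → ∣ A ++ F ∣ ≡ ∣ A ∣ + ∣ F ∣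
∣++∣ []            F = refl
∣++∣ (inside  ∷ A) F = cong suc (∣++∣ A F)
∣++∣ (outside ∷ A) F = ∣++∣ A F

-- The `e` empty positions translate A by e; F fills the positions above the translate.
extend : ∀ e → Subset u → Subset v → Subset (e + (u + v))
extend e A F = ∅ {e} ++ (A ++ F)

∣extend∣ : ∀ e (A : Subset u) (F : Subset v) → ∣ extend e A F ∣ ≡ ∣ A ∣ + ∣ F ∣
∣extend∣ e A F = trans (∣++∣ (∅ {e}) (A ++ F)) (cong₂ _+_ (∣⊥∣≡0 e) (∣++∣ A F))

extend-injective : ∀ e {A A′ : Subset u} {F F′ : Subset v} →
                   extend e A F ≡ extend e A′ F′ → A ≡ A′ × F ≡ F′
extend-injective e {A} {A′} eq = ++-injective A A′ (proj₂ (++-injective (∅ {e}) ∅ eq))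

Elem-extend⁻ : ∀ e (A : Subset u) (F : Subset v) {x : ℕ} → Elem (extend e A F) x →
  (∃ λ y → x ≡ e + y × Elem A y) ⊎ (∃ λ y → x ≡ e + (u + y) × Elem F y)
Elem-extend⁻ e A F x∈ with Elem-++⁻ (∅ {e}) x∈
... | inj₁ (_ , _ , j∈∅)  = contradiction j∈∅ ∉⊥
... | inj₂ (y , refl , y∈) with Elem-++⁻ A y∈
... | inj₁ y∈A              = inj₁ (y , refl , y∈A)
... | inj₂ (z , refl , z∈F) = inj₂ (z , refl , z∈F)

no-elements⇒∅ : (S : Subset u) → (∀ {x} → ¬ Elem S x) → S ≡ ∅
no-elements⇒∅ S none = Empty-unique λ (j , j∈S) → none (j , refl , j∈S)

-- Admissible sets and the interval (n/4, n/2)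

Admissible : ℕ → Subset N → Set
Admissible n S = MinGen (Elem S) × ¬ Gen (Elem S) n

-- This is `HSet` with the ambient size freed from n, so that `c n` can be rewritten as a sum while
-- n stays fixed.
Counted : ℕ → ℕ → Subset N → Set
Counted n i S = ∣ S ∣ ≡ i × Admissible n S

TripleFree : ℕ → (ℕ → Set) → Set
TripleFree n P = ∀ {x y z} → P x → P y → P z → x + y + z ≢ n

∉Gen⇒TripleFree : ∀ {n} {P : ℕ → Set} → ¬ Gen P n → TripleFree n P
∉Gen⇒TripleFree n∉ px py pz refl = n∉ (Gen-+ (Gen-+ Gen-[ px ] Gen-[ py ]) Gen-[ pz ])

one-below : ∀ {n a} → 2 * a < n → a + 0 ≢ n
one-below {n} {a} a< eq = absurd-≤ a (a< ⊕ ≤-reflexive (sym eq)) (solve (a ⨾ n ⨾ ε))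

two-below : ∀ {n a e} → 2 * a < n → 2 * e < n → a + (e + 0) ≢ n
two-below {n} {a} {e} a< e< eq =
  absurd-≤ 1 (a< ⊕ e< ⊕ 2 ⊛ ≤-reflexive (sym eq)) (solve (a ⨾ e ⨾ n ⨾ ε))

two-exceed : ∀ {n x a e} r → n < 4 * a → n < 4 * e → 2 * x < n → a + (e + r) ≢ x
two-exceed {n} {x} {a} {e} r <a <e x< eq =
  absurd-≤ (3 + 4 * r) (<a ⊕ <e ⊕ 2 ⊛ x< ⊕ 4 ⊛ ≤-reflexive eq) (solve (a ⨾ e ⨾ r ⨾ n ⨾ x ⨾ ε))

four-exceed : ∀ {n a e f g} r → n < 4 * a → n < 4 * e → n < 4 * f → n < 4 * g →
              a + (e + (f + (g + r))) ≢ n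
four-exceed {n} {a} {e} {f} {g} r <a <e <f <g eq =
  absurd-≤ (3 + 4 * r) (<a ⊕ <e ⊕ <f ⊕ <g ⊕ 4 ⊛ ≤-reflexive eq)
    (solve (a ⨾ e ⨾ f ⨾ g ⨾ r ⨾ n ⨾ ε))

-- Two elements above n/4 already sum to more than n/2, so no element is a sum of two or more.
quarter-half⇒MinGen : ∀ {n} {P : ℕ → Set} → (∀ {x} → P x → n < 4 * x) → (∀ {x} → P x → 2 * x < n) →
                      MinGen P
quarter-half⇒MinGen {n} {P} n<4x 2x<n x px same = not-generated (from (same x) Gen-[ px ]) refl
  where
  not-generated : ∀ {y} → Gen (λ z → P z × z ≢ x) y → y ≢ x
  not-generated gen0 refl = contradiction (n<4x px) (λ ())
  not-generated (genStep (_ , a≢x) gen0) a+0≡x = a≢x (trans (sym (+-identityʳ _)) a+0≡x)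
  not-generated (genStep {a} (pa , _) (genStep {c} {r} (pc , _) g)) eq =
    two-exceed {a = a} {c} r (n<4x pa) (n<4x pc) (2x<n px) eq

-- At most two summands stay below n and at least four exceed it, which leaves exactly three.
quarter-half⇒∉Gen : ∀ {n} {P : ℕ → Set} → 0 < n → (∀ {x} → P x → n < 4 * x) →
                    (∀ {x} → P x → 2 * x < n) → TripleFree n P → ¬ Gen P n
quarter-half⇒∉Gen {n} {P} n>0 n<4x 2x<n free g = not-generated g refl
  where
  not-generated : ∀ {y} → Gen P y → y ≢ n
  not-generated gen0 refl = contradiction n>0 (λ ())
  not-generated (genStep {a} pa gen0) a+0≡n =
    one-below {a = a} (2x<n pa) a+0≡n
  not-generated (genStep {a} pa (genStep {c} pc gen0)) eq =
    two-below {a = a} {c} (2x<n pa) (2x<n pc) eq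
  not-generated (genStep {a} pa (genStep {c} pc (genStep {f} pf gen0))) eq =
    free pa pc pf (trans (trans (+-assoc a c f) (cong (λ i → a + (c + i)) (sym (+-identityʳ f)))) eq)
  not-generated (genStep {a} pa (genStep {c} pc (genStep {f} pf (genStep {g} {r} pg _)))) eq =
    four-exceed {a = a} {c} {f} {g} r (n<4x pa) (n<4x pc) (n<4x pf) (n<4x pg) eq

-- Divisions are replaced by linear relations between q, d, N and n = 3q + b, so that the same facts
-- serve m and n.
module Frame {q b d k : ℕ} (S : Subset N) (N≡q+d : N ≡ q + d)
             (n>2N : 2 * N < 3 * q + b) (n≤2N+2 : 3 * q + b ≤ 2 * N + 2) where

  bound : Admissible (3 * q + b) S → ∀ {x} → Elem S x →
          2 * ∣ S ∣ + (3 * q + b) ≤ x + (2 * (q + d) + 1)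
  bound (minimal , n∉) {x} x∈S = subst (λ i → 2 * ∣ S ∣ + (3 * q + b) ≤ x + (2 * i + 1)) N≡q+d
    (Residues.residue-bound n>2N minimal n∉ n≤2N+2 x∈S)

  -- More than d elements would force each of them above q by `bound`, but only d positions lie
  -- there.
  size≤d : Admissible (3 * q + b) S → ∣ S ∣ ≤ d
  size≤d adm = ≮⇒≥ λ d<∣S∣ → <⇒≱ d<∣S∣ (∣S∣≤N∸q {q = q} S λ {x} x∈S →
    ≰⇒> (λ x≤q → case bound adm x∈S of λ bd → too-small ∣ S ∣ x d<∣S∣ x≤q bd) ,
    subst (x ≤_) N≡q+d (Elem⇒≤ x∈S))
    where
    too-small : ∀ s x → d < s → x ≤ q → 2 * s + (3 * q + b) ≤ x + (2 * (q + d) + 1) → ⊥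
    too-small s x d<s x≤q bd = absurd-≤ b (2 ⊛ d<s ⊕ x≤q ⊕ bd) (solve (s ⨾ x ⨾ d ⨾ q ⨾ b ⨾ ε))

  -- In 2k + 1, the 2k is twice the number of elements possibly missing from d, and the 1 is that of
  -- 2N + 1 in `residue-bound`.
  large : Admissible (3 * q + b) S → d ≤ ∣ S ∣ + k → ∀ {x} → Elem S x → q + b ≤ x + (2 * k + 1)
  large adm d≤∣S∣+k {x} x∈S = ≮⇒≥ λ lt → too-small ∣ S ∣ x d≤∣S∣+k (bound adm x∈S) lt
    where
    too-small : ∀ s x → d ≤ s + k → 2 * s + (3 * q + b) ≤ x + (2 * (q + d) + 1) →
                x + (2 * k + 1) < q + b → ⊥
    too-small s x d≤s+k bd lt = absurd-≤ 0 (2 ⊛ d≤s+k ⊕ bd ⊕ lt) (solve (s ⨾ x ⨾ d ⨾ q ⨾ b ⨾ k ⨾ ε))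

  -- The first hypothesis is what turns x ≥ q + b - (2k + 1) into 4x > 3q + b.
  admissible : 8 * k + 5 ≤ q + 3 * b → (∀ {x} → Elem S x → q + b ≤ x + (2 * k + 1)) →
               TripleFree (3 * q + b) (Elem S) → Admissible (3 * q + b) S
  admissible 8k+5≤q+3b large free =
    quarter-half⇒MinGen n<4x 2x<n , quarter-half⇒∉Gen (≤-trans z<s n>2N) n<4x 2x<n free
    where
    2x<n : ∀ {x} → Elem S x → 2 * x < 3 * q + b
    2x<n x∈S = ≤-<-trans (*-monoʳ-≤ 2 (Elem⇒≤ x∈S)) n>2N
    n<4x : ∀ {x} → Elem S x → 3 * q + b < 4 * x
    n<4x {x} x∈S = ≰⇒> λ 4x≤n → too-small x 4x≤n (large x∈S)
      where
      too-small : ∀ x → 4 * x ≤ 3 * q + b → q + b ≤ x + (2 * k + 1) → ⊥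
      too-small x 4x≤n lg = absurd-≤ 0 (4x≤n ⊕ 4 ⊛ lg ⊕ 8k+5≤q+3b) (solve (x ⨾ q ⨾ b ⨾ k ⨾ ε))

-- Passing from m to n

-- In the application p = ⌊m/3⌋, p + e = ⌊n/3⌋, d = `d m`, d + D = `d n` and M = `c m`. The ambient
-- size for n is written in the form that `extend` produces.
module Extension
  {k b p e d M : ℕ} (D : ℕ) (b≤2 : b ≤ 2) (8k+5≤p+3b : 8 * k + 5 ≤ p + 3 * b) (4k+2≤d+b : 4 * k + 2 ≤ d + b)
  (M≡p+d : M ≡ p + d) (m>2M : 2 * M < 3 * p + b) (m≤2M+2 : 3 * p + b ≤ 2 * M + 2)
  (n>2N : 2 * (e + (M + D)) < 3 * (p + e) + b) (n≤2N+2 : 3 * (p + e) + b ≤ 2 * (e + (M + D)) + 2)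
  where

  m n : ℕ
  m = 3 * p + b
  n = 3 * (p + e) + b

  N≡q+d+D : e + (M + D) ≡ (p + e) + (d + D)
  N≡q+d+D = trans (cong (λ i → e + (i + D)) M≡p+d) (lemma e p d D)
    where
    lemma : ∀ e p d D → e + ((p + d) + D) ≡ (p + e) + (d + D)
    lemma e p d D = solve (e ⨾ p ⨾ d ⨾ D ⨾ ε)

  module FrameM (A : Subset M) = Frame {q = p} {b} {d} {k} A M≡p+d m>2M m≤2M+2
  module FrameN (S : Subset (e + (M + D))) = Frame {q = p + e} {b} {d + D} {k} S N≡q+d+D n>2N n≤2N+2

  Large : ℕ → ℕ → Set
  Large q x = q + b ≤ x + (2 * k + 1)

  Large-shift⁺ : ∀ {y} → Large p y → Large (p + e) (e + y)
  Large-shift⁺ {y} lg = subst₂ _≤_ (lhs p e b) (sym (+-assoc e y _)) (+-monoʳ-≤ e lg)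
    where
    lhs : ∀ p e b → e + (p + b) ≡ p + e + b
    lhs p e b = solve (p ⨾ e ⨾ b ⨾ ε)

  Large-shift⁻ : ∀ {y} → Large (p + e) (e + y) → Large p y
  Large-shift⁻ {y} lg = +-cancelˡ-≤ e _ _ (subst₂ _≤_ (sym (lhs p e b)) (+-assoc e y _) lg)
    where
    lhs : ∀ p e b → e + (p + b) ≡ p + e + b
    lhs p e b = solve (p ⨾ e ⨾ b ⨾ ε)

  -- Three shifts add 3e = n - m; here m and n need the same remainder b.
  triple-shift : ∀ {x y z} → (e + x) + (e + y) + (e + z) ≡ n ⇔ x + y + z ≡ m
  triple-shift {x} {y} {z} = mk⇔
    (λ eq → +-cancelʳ-≡ (3 * e) _ _ (trans (sym (lhs e x y z)) (trans eq (rhs p e b))))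
    (λ eq → trans (lhs e x y z) (trans (cong (_+ 3 * e) eq) (sym (rhs p e b))))
    where
    lhs : ∀ e x y z → (e + x) + (e + y) + (e + z) ≡ x + y + z + 3 * e
    lhs e x y z = solve (e ⨾ x ⨾ y ⨾ z ⨾ ε)
    rhs : ∀ p e b → 3 * (p + e) + b ≡ 3 * p + b + 3 * e
    rhs p e b = solve (p ⨾ e ⨾ b ⨾ ε)

  -- The offset is at least 1, which together with the 1 in the bound covers b ≤ 2.
  beyond-large : ∀ {y} → 0 < y → Large (p + e) (e + (M + y))
  beyond-large {y} y>0 = subst (λ i → Large (p + e) (e + (i + y))) (sym M≡p+d) (≮⇒≥ (lemma p e d k b y y>0 b≤2))
    where
    lemma : ∀ p e d k b y → 0 < y → b ≤ 2 → ¬ e + ((p + d) + y) + (2 * k + 1) < p + e + b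
    lemma p e d k b y y>0 b≤2 lt =
      absurd-≤ (d + 2 * k) (lt ⊕ y>0 ⊕ b≤2) (solve (p ⨾ e ⨾ d ⨾ k ⨾ b ⨾ y ⨾ ε))

  -- Offsets x − ⌊n/3⌋ of at least −(2k+1−b), together with one of at least d+1 > 4k+1−b, have a sum exceeding b.
  beyond-free : ∀ {x y z} → Large (p + e) x → Large (p + e) y → 0 < z → x + y + (e + (M + z)) ≢ n
  beyond-free {x} {y} {z} lx ly z>0 eq = lemma p e d k b x y z 4k+2≤d+b lx ly z>0
    (trans (cong (λ i → x + y + (e + (i + z))) (sym M≡p+d)) eq)
    where
    lemma : ∀ p e d k b x y z → 4 * k + 2 ≤ d + b → p + e + b ≤ x + (2 * k + 1) →
            p + e + b ≤ y + (2 * k + 1) → 0 < z → x + y + (e + ((p + d) + z)) ≢ 3 * (p + e) + b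
    lemma p e d k b x y z t lx ly z>0 eq = absurd-≤ 0 (t ⊕ lx ⊕ ly ⊕ z>0 ⊕ ≤-reflexive eq)
      (solve (p ⨾ e ⨾ d ⨾ k ⨾ b ⨾ x ⨾ y ⨾ z ⨾ ε))

  extend-admissible : (A : Subset M) (F : Subset D) → Admissible m A → d ≤ ∣ A ∣ + k →
                      Admissible n (extend e A F)
  extend-admissible A F adm d≤∣A∣+k = FrameN.admissible (extend e A F)
    (≤-trans 8k+5≤p+3b (+-monoˡ-≤ (3 * b) (m≤m+n p e))) large free
    where
    large : ∀ {x} → Elem (extend e A F) x → Large (p + e) x
    large x∈ with Elem-extend⁻ e A F x∈
    ... | inj₁ (y , refl , y∈A) = Large-shift⁺ (FrameM.large A adm d≤∣A∣+k y∈A)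
    ... | inj₂ (y , refl , y∈F) = beyond-large (Elem⇒>0 y∈F)
    free : TripleFree n (Elem (extend e A F))
    free {x} {y} {z} x∈ y∈ z∈ eq
      with Elem-extend⁻ e A F x∈ | Elem-extend⁻ e A F y∈ | Elem-extend⁻ e A F z∈
    ... | _ | _ | inj₂ (f , refl , f∈F) = beyond-free {x} {y} (large x∈) (large y∈) (Elem⇒>0 f∈F) eq
    -- `beyond-free` expects the new element last, so the sum is reordered here and in the next
    -- case.
    ... | _ | inj₂ (f , refl , f∈F) | _ = beyond-free {x} {z} (large x∈) (large z∈) (Elem⇒>0 f∈F)
      (trans (trans (+-assoc x z y) (trans (cong (x +_) (+-comm z y)) (sym (+-assoc x y z)))) eq)
    ... | inj₂ (f , refl , f∈F) | _ | _ = beyond-free {y} {z} (large y∈) (large z∈) (Elem⇒>0 f∈F)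
      (trans (trans (+-comm (y + z) x) (sym (+-assoc x y z))) eq)
    ... | inj₁ (x′ , refl , x∈A) | inj₁ (y′ , refl , y∈A) | inj₁ (z′ , refl , z∈A) =
      ∉Gen⇒TripleFree (proj₂ adm) x∈A y∈A z∈A (to triple-shift eq)

  -- Translation does not respect sums of arbitrary length, so only the lower bound and
  -- triple-freeness are carried back; both conditions for m are then rederived from them.
  restrict-admissible : (A : Subset M) (F : Subset D) → Admissible n (extend e A F) →
                        d + D ≤ ∣ extend e A F ∣ + k → Admissible m A
  restrict-admissible A F adm sz = FrameM.admissible A 8k+5≤p+3b
    (λ y∈A → Large-shift⁻ (FrameN.large (extend e A F) adm sz (lift y∈A)))
    (λ x∈A y∈A z∈A eq →
      ∉Gen⇒TripleFree (proj₂ adm) (lift x∈A) (lift y∈A) (lift z∈A) (from triple-shift eq))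
    where
    lift : ∀ {y} → Elem A y → Elem (extend e A F) (e + y)
    lift y∈A = Elem-++⁺ʳ ∅ (Elem-++⁺ˡ y∈A)

  -- An element x ≤ e would give p + b ≤ 2k + 1, against 8k + 5 ≤ p + 3b and b ≤ 2. So the first e
  -- positions are empty.
  split : (S : Subset (e + (M + D))) → Admissible n S → d + D ≤ ∣ S ∣ + k →
          ∃₂ λ A F → S ≡ extend e A F
  split S adm sz with splitAt e S
  ... | E , R , refl with splitAt M R
  ... | A , F , refl = A , F , cong (_++ (A ++ F)) (no-elements⇒∅ E λ {x} x∈E →
    lemma p e k b x 8k+5≤p+3b b≤2 (Elem⇒≤ x∈E) (Elem⇒>0 x∈E)
      (FrameN.large (E ++ (A ++ F)) adm sz (Elem-++⁺ˡ x∈E)))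
    where
    lemma : ∀ p e k b x → 8 * k + 5 ≤ p + 3 * b → b ≤ 2 → x ≤ e → 0 < x → ¬ p + e + b ≤ x + (2 * k + 1)
    lemma p e k b x t b≤2 x≤e x>0 lg = absurd-≤ (p + 4 * k) (t ⊕ b≤2 ⊕ 2 ⊛ lg ⊕ 2 ⊛ x≤e)
      (solve (p ⨾ e ⨾ k ⨾ b ⨾ x ⨾ ε))

  -- This makes `d ∸ l` for l ≤ k and `d + D ∸ k` true differences.
  k≤d : k ≤ d
  k≤d = lemma k b d b≤2 4k+2≤d+b
    where
    lemma : ∀ k b d → b ≤ 2 → 4 * k + 2 ≤ d + b → k ≤ d
    lemma k b d b≤2 t = ≤-trans (m≤m+n k _) (+-cancelʳ-≤ 2 _ _ (≤-trans t (+-monoʳ-≤ d b≤2)))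

  -- Of the k elements missing in total, l are missing from A and k - l from the new positions.
  Layer : ℕ → Subset (e + (M + D)) → Set
  Layer l = Image₂ (extend e) (Counted m (d ∸ l)) (CoSize D (k ∸ l))

  Counted⇔Layers : ∀ S → Counted n (d + D ∸ k) S ⇔ (∃ λ l → l ≤ k × Layer l S)
  Counted⇔Layers S = mk⇔ decompose compose
    where
    decompose : Counted n (d + D ∸ k) S → ∃ λ l → l ≤ k × Layer l S
    decompose (size , adm) = peel (split S adm (≤-reflexive (sym ∣S∣+k≡d+D)))
      where
      ∣S∣+k≡d+D : ∣ S ∣ + k ≡ d + D
      ∣S∣+k≡d+D = trans (cong (_+ k) size) (m∸n+n≡m (≤-trans k≤d (m≤m+n d D)))
      peel : (∃₂ λ A F → S ≡ extend e A F) → ∃ λ l → l ≤ k × Layer l S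
      peel (A , F , refl) = l , l≤k , A , F ,
        (sym (m∸[m∸n]≡n ∣A∣≤d) , adm-A) ,
        +-cancelʳ-≡ (l + ∣ A ∣) _ _ (trans (regroup (∣ F ∣) (k ∸ l) l (∣ A ∣))
          (trans (cong (λ i → ∣ A ∣ + ∣ F ∣ + i) (m∸n+n≡m l≤k))
            (trans total (trans (+-comm d D) (cong (D +_) (sym (m∸n+n≡m ∣A∣≤d))))))) ,
        refl
        where
        -- The subtraction is not truncated, by `size≤d` applied for m.
        l = d ∸ ∣ A ∣
        adm-A : Admissible m A
        adm-A = restrict-admissible A F adm (≤-reflexive (sym ∣S∣+k≡d+D))
        ∣A∣≤d : ∣ A ∣ ≤ d
        ∣A∣≤d = FrameM.size≤d A adm-A
        total : ∣ A ∣ + ∣ F ∣ + k ≡ d + D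
        total = trans (cong (_+ k) (sym (∣extend∣ e A F))) ∣S∣+k≡d+D
        -- F fills at most D positions, so A alone falls short of d by at most k.
        d≤∣A∣+k : ∀ a f → f ≤ D → a + f + k ≡ d + D → d ≤ a + k
        d≤∣A∣+k a f f≤D eq = +-cancelʳ-≤ D _ _ (subst (_≤ a + k + D) eq
          (≤-trans (≤-reflexive (lemma a f k)) (+-monoʳ-≤ (a + k) f≤D)))
          where
          lemma : ∀ a f k → a + f + k ≡ a + k + f
          lemma a f k = solve (a ⨾ f ⨾ k ⨾ ε)
        l≤k : l ≤ k
        l≤k = m≤n+o⇒m∸n≤o d ∣ A ∣ (d≤∣A∣+k (∣ A ∣) (∣ F ∣) (∣p∣≤n F) total)
        regroup : ∀ f j l a → f + j + (l + a) ≡ a + f + (j + l)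
        regroup f j l a = solve (f ⨾ j ⨾ l ⨾ a ⨾ ε)
    compose : (∃ λ l → l ≤ k × Layer l S) → Counted n (d + D ∸ k) S
    compose (l , l≤k , A , F , (∣A∣≡d∸l , adm) , coSize , refl) =
      trans (sym (m+n∸n≡m _ k)) (cong (_∸ k) total) , extend-admissible A F adm d≤∣A∣+k
      where
      ∣A∣+l≡d : ∣ A ∣ + l ≡ d
      ∣A∣+l≡d = trans (cong (_+ l) ∣A∣≡d∸l) (m∸n+n≡m (≤-trans l≤k k≤d))
      d≤∣A∣+k : d ≤ ∣ A ∣ + k
      d≤∣A∣+k = subst (_≤ ∣ A ∣ + k) ∣A∣+l≡d (+-monoʳ-≤ ∣ A ∣ l≤k)
      regroup : ∀ a f j l → a + f + (j + l) ≡ a + l + (f + j)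
      regroup a f j l = solve (a ⨾ f ⨾ j ⨾ l ⨾ ε)
      total : ∣ extend e A F ∣ + k ≡ d + D
      total = trans (cong₂ _+_ (∣extend∣ e A F) (sym (m∸n+n≡m l≤k)))
        (trans (regroup (∣ A ∣) (∣ F ∣) (k ∸ l) l) (cong₂ _+_ ∣A∣+l≡d coSize))

  IsCount-Layers : {g : ℕ → ℕ} → (∀ l → IsCount {M} (Counted m (d ∸ l)) (g l)) →
    IsCount (λ S → ∃ λ l → l ≤ k × Layer l S) (sumTo k λ l → g l * (D C (k ∸ l)))
  IsCount-Layers counts = IsCount-sumTo k disjoint λ l l≤k →
    IsCount-Image₂ (extend e) (extend-injective e) (counts l) (IsCount-CoSize D (k ∸ l))
    where
    -- S determines F, and ∣F∣ determines k - l, hence l as l ≤ k.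
    disjoint : ∀ {i j S} → i ≤ k → j ≤ k → Layer i S → Layer j S → i ≡ j
    disjoint i≤k j≤k (A , F , _ , sizeF , refl) (A′ , F′ , _ , sizeF′ , eq)
      with refl ← proj₂ (extend-injective e {A} {A′} eq) =
      ∸-cancelˡ-≡ i≤k j≤k (+-cancelˡ-≡ ∣ F ∣ _ _ (trans sizeF (sym sizeF′)))

-- Linear arithmetic of ⌊n/3⌋ and ⌊(n-1)/2⌋

record Thirds (n q b c d : ℕ) : Set where
  field
    n≡3q+b : n ≡ 3 * q + b
    c≡q+d  : c ≡ q + d
    n>2c   : 2 * c < n
    n≤2c+2 : n ≤ 2 * c + 2

-- If c < q, then 3c + 3 ≤ n ≤ 2c + 2, which is absurd; so `d n` is a true difference.
thirds : ∀ {n b} → 0 < n → n % 3 ≡ b → Thirds n (n / 3) b (c n) (d n)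
thirds {n@(suc n-1)} {b} _ n%3≡b = record
  { n≡3q+b = n≡3q+b
  ; c≡q+d  = sym (m+[n∸m]≡n (≮⇒≥ λ c<q → q≤c n-1 (n / 3) b (c n) c<q n≡3q+b n≤2c+2))
  ; n>2c   = s≤s (subst (2 * c n ≤_) (sym n-1≡) (subst (_≤ n-1 % 2 + c n * 2) (*-comm (c n) 2) (m≤n+m _ (n-1 % 2))))
  ; n≤2c+2 = n≤2c+2
  }
  where
  n≡3q+b : n ≡ 3 * (n / 3) + b
  n≡3q+b = trans (m≡m%n+[m/n]*n n 3)
    (trans (cong₂ _+_ n%3≡b (*-comm (n / 3) 3)) (+-comm b (3 * (n / 3))))
  n-1≡ : n-1 ≡ n-1 % 2 + c n * 2
  n-1≡ = m≡m%n+[m/n]*n n-1 2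
  n≤2c+2 : n ≤ 2 * c n + 2
  n≤2c+2 = ≮⇒≥ (bound n-1 (n-1 % 2) (c n) (m%n<n n-1 2) n-1≡)
    where
    bound : ∀ i r j → r < 2 → i ≡ r + j * 2 → ¬ 2 * j + 2 < suc i
    bound i r j r<2 eq lt = absurd-≤ 0 (lt ⊕ r<2 ⊕ ≤-reflexive eq) (solve (i ⨾ r ⨾ j ⨾ ε))
  q≤c : ∀ i q b j → j < q → suc i ≡ 3 * q + b → suc i ≤ 2 * j + 2 → ⊥
  q≤c i q b j j<q eq bd = absurd-≤ (b + j) (3 ⊛ j<q ⊕ ≤-reflexive (sym eq) ⊕ bd) (solve (i ⨾ q ⨾ b ⨾ j ⨾ ε))


module _ {k b m p c d n q c′ d′ : ℕ} (b≤2 : b ≤ 2) (24k+12<m+8b : 24 * k + 12 < m + 8 * b) (p≤q : p ≤ q)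
         (thirds-m : Thirds m p b c d) (thirds-n : Thirds n q b c′ d′) where

  open Thirds thirds-m using () renaming
    (n≡3q+b to m≡3p+b; c≡q+d to c≡p+d; n>2c to m>2c; n≤2c+2 to m≤2c+2)
  open Thirds thirds-n using () renaming
    (n≡3q+b to n≡3q+b; c≡q+d to c′≡q+d′; n>2c to n>2c′; n≤2c+2 to n≤2c′+2)

  -- The threshold reads 24k + 12 < 3p + 9b; divide by 3.
  8k+5≤p+3b : 8 * k + 5 ≤ p + 3 * b
  8k+5≤p+3b = ≮⇒≥ (lemma k b p m 24k+12<m+8b m≡3p+b)
    where
    lemma : ∀ k b p m → 24 * k + 12 < m + 8 * b → m ≡ 3 * p + b → ¬ p + 3 * b < 8 * k + 5
    lemma k b p m lt eq lt′ = absurd-≤ 0 (lt ⊕ ≤-reflexive eq ⊕ 3 ⊛ lt′) (solve (k ⨾ b ⨾ p ⨾ m ⨾ ε))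

  -- From 3p + b ≤ 2(p + d) + 2 follows 2(d + b) ≥ p + 3b - 2 ≥ 8k + 3, and parity rounds this up.
  4k+2≤d+b : 4 * k + 2 ≤ d + b
  4k+2≤d+b = ≮⇒≥ (lemma k b p c d m 8k+5≤p+3b m≡3p+b c≡p+d m≤2c+2)
    where
    lemma : ∀ k b p c d m → 8 * k + 5 ≤ p + 3 * b → m ≡ 3 * p + b → c ≡ p + d → m ≤ 2 * c + 2 →
            ¬ d + b < 4 * k + 2
    lemma k b p c d m t eq eq′ bd lt = absurd-≤ 0
      (t ⊕ ≤-reflexive (sym eq) ⊕ 2 ⊛ ≤-reflexive eq′ ⊕ bd ⊕ 2 ⊛ lt)
      (solve (k ⨾ b ⨾ p ⨾ c ⨾ d ⨾ m ⨾ ε))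

  -- The chain is 2d < p + b ≤ q + b ≤ 2d′ + 2.
  d≤d′ : d ≤ d′
  d≤d′ = ≮⇒≥ (lemma b p q c c′ d d′ m n p≤q m≡3p+b c≡p+d m>2c n≡3q+b c′≡q+d′ n≤2c′+2)
    where
    lemma : ∀ b p q c c′ d d′ m n → p ≤ q → m ≡ 3 * p + b → c ≡ p + d → 2 * c < m →
            n ≡ 3 * q + b → c′ ≡ q + d′ → n ≤ 2 * c′ + 2 → ¬ d′ < d
    lemma b p q c c′ d d′ m n p≤q eq₁ eq₂ lt eq₃ eq₄ bd lt′ = absurd-≤ 0
      (p≤q ⊕ ≤-reflexive eq₁ ⊕ 2 ⊛ ≤-reflexive (sym eq₂) ⊕ lt ⊕ ≤-reflexive (sym eq₃)
        ⊕ 2 ⊛ ≤-reflexive eq₄ ⊕ bd ⊕ 2 ⊛ lt′)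
      (solve (b ⨾ p ⨾ q ⨾ c ⨾ c′ ⨾ d ⨾ d′ ⨾ m ⨾ n ⨾ ε))

  -- Both sides count one family of sets, once directly and once by layers; the rest is transport
  -- along the equations for n, `d′` and `c′`.
  layer-count : {f g : ℕ → ℕ} → (∀ i → IsCount {c} (Counted m i) (f i)) →
    (∀ i → IsCount {c′} (Counted n i) (g i)) →
    g (d′ ∸ k) ≡ sumTo k (λ l → f (d ∸ l) * ((d′ ∸ d) C (k ∸ l)))
  layer-count {f} {g} f-counts g-counts =
    IsCount-unique Counted⇔Layers count-n (IsCount-Layers count-m)
    where
    e D : ℕ
    e = q ∸ p
    D = d′ ∸ d
    p+e≡q : p + e ≡ q
    p+e≡q = m+[n∸m]≡n p≤q
    d′≡d+D : d′ ≡ d + D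
    d′≡d+D = sym (m+[n∸m]≡n d≤d′)
    c′≡N : c′ ≡ e + (c + D)
    c′≡N = trans c′≡q+d′ (trans (cong₂ _+_ (sym p+e≡q) d′≡d+D)
      (trans (lemma p e d D) (cong (λ i → e + (i + D)) (sym c≡p+d))))
      where
      lemma : ∀ p e d D → (p + e) + (d + D) ≡ e + ((p + d) + D)
      lemma p e d D = solve (p ⨾ e ⨾ d ⨾ D ⨾ ε)
    n≡ : n ≡ 3 * (p + e) + b
    n≡ = trans n≡3q+b (cong (λ i → 3 * i + b) (sym p+e≡q))
    open Extension {k} {b} {p} {e} {d} {c} D b≤2 8k+5≤p+3b 4k+2≤d+b c≡p+d
      (subst (2 * c <_) m≡3p+b m>2c) (subst (_≤ 2 * c + 2) m≡3p+b m≤2c+2)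
      (subst₂ (λ N n → 2 * N < n) c′≡N n≡ n>2c′) (subst₂ (λ N n → n ≤ 2 * N + 2) c′≡N n≡ n≤2c′+2)
      using (Counted⇔Layers; IsCount-Layers)
    count-m : ∀ l → IsCount {c} (Counted (3 * p + b) (d ∸ l)) (f (d ∸ l))
    count-m l = subst (λ i → IsCount {c} (Counted i (d ∸ l)) (f (d ∸ l))) m≡3p+b (f-counts (d ∸ l))
    count-n : IsCount {e + (c + D)} (Counted (3 * (p + e) + b) (d + D ∸ k)) (g (d′ ∸ k))
    count-n = subst (λ i → IsCount {e + (c + D)} (Counted i (d + D ∸ k)) (g (d′ ∸ k))) n≡
      (subst (λ i → IsCount {e + (c + D)} (Counted n (i ∸ k)) (g (d′ ∸ k))) d′≡d+D
        (subst (λ N → IsCount {N} (Counted n (d′ ∸ k)) (g (d′ ∸ k))) c′≡N (g-counts (d′ ∸ k))))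

-- For m = 0 the remainder b is 0 as well, which the threshold excludes.
threshold⇒>0 : ∀ k {b m} → 24 * k + 12 < m + 8 * b → m % 3 ≡ b → 0 < m
threshold⇒>0 k {m = zero}  threshold refl = contradiction threshold (λ ())
threshold⇒>0 k {m = suc m} _ _            = z<s

theorem1 : (h : ℕ → ℕ → ℕ) → (∀ n i → IsCount (HSet n i) (h n i)) →
    (k b m : ℕ) → b < 3 → 24 * k + 12 < m + 8 * b → m % 3 ≡ b →
    (n : ℕ) → m ≤ n → n % 3 ≡ b →
    h n (d n ∸ k) ≡ sumTo k (λ l → h m (d m ∸ l) * ((d n ∸ d m) C (k ∸ l)))
theorem1 h h-counts k b m b<3 24k+12<m+8b m%3≡b n m≤n n%3≡b =
  layer-count {k = k} (s≤s⁻¹ b<3) 24k+12<m+8b (/-monoˡ-≤ 3 m≤n)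
    (thirds m>0 m%3≡b) (thirds (<-≤-trans m>0 m≤n) n%3≡b) (h-counts m) (h-counts n)
  where
  m>0 : 0 < m
  m>0 = threshold⇒>0 k 24k+12<m+8b m%3≡b
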